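{- For every integer $n \ge 1$, $R(Q_n, Q_n) \le n^2 - n + 2$.
   Context: $Q_k$ denotes the Boolean lattice of dimension $k$: the family of all subsets of a $k$-element ground set (e.g. $[k]=\{1,\dots,k\}$), ordered by inclusion. A subposet $Q'$ of a poset $Q$ is a copy of a poset $P$ if there is a bijection $f$ from $P$ to $Q'$ such that $x \le y$ in $P$ if and only if $f(x) \le f(y)$ in $Q$. For posets $P, P'$, the poset Ramsey number $R(P,P')$ is the smallest integer $N$ such that for every coloring of the elements of $Q_N$ in red and blue, there is a copy of $P$ all of whose elements are red or a copy of $P'$ all of whose elements are blue. -}

module Defs where

open import Data.Nat using (ℕ)
open import Data.Bool using (Bool; true; false)
open import Data.Fin.Subset using (Subset; _⊆_)
open import Data.Product using (Σ; _×_)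
open import Data.Sum using (_⊎_)
open import Relation.Binary.PropositionalEquality using (_≡_)
open import Function.Bundles using (_⇔_)

Q : ℕ → Set
Q k = Subset k

Colouring : ℕ → Set
Colouring N = Q N → Bool

red blue : Bool
red = true
blue = false

-- A copy of Q_n inside Q_N: a map f : Q_n → Q_N with x ⊆ y ⇔ f x ⊆ f y.
-- (Such an f is automatically injective by antisymmetry of ⊆, so it is a
-- bijection onto its image Q', which is then a copy of Q_n.)
IsCopy : (n N : ℕ) → (Q n → Q N) → Set
IsCopy n N f = ∀ (x y : Q n) → (x ⊆ y) ⇔ (f x ⊆ f y)

MonoCopy : (n N : ℕ) → Colouring N → Bool → Set
MonoCopy n N c col =
  Σ (Q n → Q N) (λ f → IsCopy n N f × (∀ (x : Q n) → c (f x) ≡ col))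

Arrows : (N m n : ℕ) → Set
Arrows N m n = ∀ (c : Colouring N) → MonoCopy m N c red ⊎ MonoCopy n N c blue

-- "R(Q_m, Q_n) ≤ M", i.e. the least N with Arrows N m n is at most M,
-- unfolded as: some N ≤ M satisfies Arrows N m n.
RamseyLE : (m n M : ℕ) → Set
RamseyLE m n M = Σ ℕ (λ N → (N Data.Nat.≤ M) × Arrows N m n)

{-# OPTIONS --safe #-}

-- Put the n-set to be embedded on n coordinates and let the level of S decide which other
-- coordinates may still be used.  A level that owns a private block of n coordinates can always be
-- coloured p, unless the subsets of the block give a copy of Q_n in the other colour.  So n² ∸ n
-- coordinates suffice once only n ∸ 2 levels need a block: when the first three levels come for
-- free, or when ⊥, ⊤ and n atoms have colour p.  In the latter case ⊥ and ⊤ may be exchanged for a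
-- smaller and a larger set of colour p.
--
-- Let n ≥ 3 and N = n² ∸ n + 2.  If no set of size at most 2 has the colour of ⊤, three levels are
-- free.  Otherwise [S , ⊤] has ends of equal colour for some S of size at most 2, so some coatom U
-- has the colour opposite to ⊤.  Now U and ⊤ show both colours, so [⊥ , U] may be given ends of
-- equal colour, and some atom X ⊆ U has the colour opposite to ⊥.  The interval [X , U] has
-- dimension n² ∸ n ≥ 2n ∸ 1, so n of its atoms agree in colour, and that colour occurs both below X
-- and above U.  For n = 2 the last inequality fails, and Q_4 is settled by a search.
module Submission where

open import Defs
open import Data.Bool using (Bool; true; false; not)
open import Data.Bool.Properties using (_≟_; ¬-not; not-involutive)
open import Data.Empty using (⊥-elim)
open import Data.Fin using (zero; suc)
open import Data.Fin.Subset using (Subset; inside; outside; _⊆_; _⊈_; ⊥; ⊤; ⁅_⁆; ∁; ∣_∣)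
open import Data.Fin.Subset.Properties
open import Data.List using (List; []; _∷_)
open import Data.List.Relation.Unary.All as All using (All; []; _∷_)
open import Data.List.Relation.Unary.Any using (Any; any?)
open import Data.Maybe using (Maybe; just; nothing; zipWith; from-just)
open import Data.Nat using (ℕ; zero; suc; _≤_; _<_; z≤n; s≤s; _*_; _∸_; _+_)
open import Data.Nat.Properties hiding (_≟_)
open import Data.Product using (∃; ∃₂; _×_; _,_)
open import Data.Sum using (_⊎_; inj₁; inj₂)
open import Data.Vec using ([]; _∷_; here)
open import Data.Vec.Properties using (≡-dec)
open import Function using (_∘_; id; case_of_)
open import Function.Bundles using (mk⇔; Equivalence)
open import Relation.Nullary using (Dec; yes; no; ¬?; _×-dec_; decidable-stable)
open import Relation.Binary.PropositionalEquality

private variable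
  m n r t N : ℕ
  x y : Bool
  S S′ : Subset n

-- Monochromatic copies: composition and duality.

Mono : (n N : ℕ) → Colouring N → Set
Mono n N c = MonoCopy n N c red ⊎ MonoCopy n N c blue

mono : ∀ (c : Colouring N) p → MonoCopy n N c p → Mono n N c
mono c true  = inj₁
mono c false = inj₂

isCopy : ∀ {f : Q n → Q N} → (∀ x y → x ⊆ y → f x ⊆ f y) → (∀ x y → f x ⊆ f y → x ⊆ y) → IsCopy n N f
isCopy to from x y = mk⇔ (to x y) (from x y)

copy-mono : ∀ {f : Q n → Q N} → IsCopy n N f → ∀ x y → x ⊆ y → f x ⊆ f y
copy-mono F x y = Equivalence.to (F x y)

copy-cancel : ∀ {f : Q n → Q N} → IsCopy n N f → ∀ x y → f x ⊆ f y → x ⊆ y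
copy-cancel F x y = Equivalence.from (F x y)

IsCopy-∘ : ∀ {f : Q n → Q m} {g : Q m → Q N} → IsCopy m N g → IsCopy n m f → IsCopy n N (g ∘ f)
IsCopy-∘ {f = f} G F = isCopy
  (λ x y le → copy-mono G (f x) (f y) (copy-mono F x y le))
  (λ x y le → copy-cancel F x y (copy-cancel G (f x) (f y) le))

MonoCopy-∘ : ∀ (c : Colouring N) {g : Q m → Q N} {p} → IsCopy m N g →
             MonoCopy n m (c ∘ g) p → MonoCopy n N c p
MonoCopy-∘ c G (f , F , col) = _ , IsCopy-∘ G F , col

Mono-∘ : ∀ (c : Colouring N) {g : Q m → Q N} → IsCopy m N g → Mono n m (c ∘ g) → Mono n N c
Mono-∘ c G (inj₁ M) = inj₁ (MonoCopy-∘ c G M)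
Mono-∘ c G (inj₂ M) = inj₂ (MonoCopy-∘ c G M)

∁-involutive : (S : Subset n) → ∁ (∁ S) ≡ S
∁-involutive []      = refl
∁-involutive (x ∷ S) = cong₂ _∷_ (not-involutive x) (∁-involutive S)

∁⊥≡⊤ : ∀ n → ∁ {n} ⊥ ≡ ⊤
∁⊥≡⊤ zero    = refl
∁⊥≡⊤ (suc n) = cong (inside ∷_) (∁⊥≡⊤ n)

-- Complementation reverses inclusion and is applied on both sides of `f`, so the order survives.
-- Facts about atoms thereby yield facts about coatoms.
MonoCopy-dual : ∀ (c : Colouring N) {p} → MonoCopy n N (c ∘ ∁) p → MonoCopy n N c p
MonoCopy-dual c (f , F , col) = (λ x → ∁ (f (∁ x))) , copy , (λ x → col (∁ x))
  where
  copy : IsCopy _ _ (λ x → ∁ (f (∁ x)))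
  copy = isCopy
    (λ x y le → p⊆q⇒∁p⊇∁q (copy-mono F (∁ y) (∁ x) (p⊆q⇒∁p⊇∁q le)))
    (λ x y le → ∁p⊆∁q⇒p⊇q (copy-cancel F (∁ y) (∁ x) (∁p⊆∁q⇒p⊇q le)))

Mono-dual : ∀ (c : Colouring N) → Mono n N (c ∘ ∁) → Mono n N c
Mono-dual c (inj₁ M) = inj₁ (MonoCopy-dual c M)
Mono-dual c (inj₂ M) = inj₂ (MonoCopy-dual c M)

-- Inclusion and splittings of the ground set.

⊆-∷ : (x ≡ inside → y ≡ inside) → S ⊆ S′ → x ∷ S ⊆ y ∷ S′
⊆-∷ {x = outside} h le = out⊆ le
⊆-∷ {x = inside} h le rewrite h refl = in⊆in le

⊆-head : x ∷ S ⊆ y ∷ S′ → x ≡ inside → y ≡ inside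
⊆-head le refl with here ← le here = refl

⊆⇒≡⊎< : S ⊆ S′ → S ≡ S′ ⊎ ∣ S ∣ < ∣ S′ ∣
⊆⇒≡⊎< {S = []} {[]} le = inj₁ refl
⊆⇒≡⊎< {S = true ∷ S} {true ∷ S′} le with ⊆⇒≡⊎< (drop-∷-⊆ le)
... | inj₁ refl = inj₁ refl
... | inj₂ lt   = inj₂ (s≤s lt)
⊆⇒≡⊎< {S = false ∷ S} {false ∷ S′} le with ⊆⇒≡⊎< (drop-∷-⊆ le)
... | inj₁ refl = inj₁ refl
... | inj₂ lt   = inj₂ lt
⊆⇒≡⊎< {S = false ∷ S} {true ∷ S′} le = inj₂ (s≤s (p⊆q⇒∣p∣≤∣q∣ (drop-∷-⊆ le)))
⊆⇒≡⊎< {S = true ∷ S} {false ∷ S′} le = case ⊆-head le refl of λ ()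

-- A splitting of an N-element ground set into a left part of size r and a right part of size t.
data Shuffle : ℕ → ℕ → ℕ → Set where
  []    : Shuffle 0 0 0
  left  : Shuffle r t N → Shuffle (suc r) t (suc N)
  right : Shuffle r t N → Shuffle r (suc t) (suc N)

merge : Shuffle r t N → Subset r → Subset t → Subset N
merge []        []      []      = []
merge (left σ)  (x ∷ S) T       = x ∷ merge σ S T
merge (right σ) S       (y ∷ T) = y ∷ merge σ S T

shuffle-size : Shuffle r t N → r + t ≡ N
shuffle-size []        = refl
shuffle-size (left σ)  = cong suc (shuffle-size σ)
shuffle-size (right σ) = trans (+-suc _ _) (cong suc (shuffle-size σ))

merge-mono : ∀ (σ : Shuffle r t N) {S S′ T T′} → S ⊆ S′ → T ⊆ T′ → merge σ S T ⊆ merge σ S′ T′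
merge-mono [] {[]} {[]} {[]} {[]} _ _ = id
merge-mono (left σ)  {x ∷ _} {y ∷ _} p q = ⊆-∷ (⊆-head p) (merge-mono σ (drop-∷-⊆ p) q)
merge-mono (right σ) {_} {_} {x ∷ _} {y ∷ _} p q = ⊆-∷ (⊆-head q) (merge-mono σ p (drop-∷-⊆ q))

merge-cancelˡ : ∀ (σ : Shuffle r t N) {S S′ T T′} → merge σ S T ⊆ merge σ S′ T′ → S ⊆ S′
merge-cancelˡ [] {[]} {[]} {[]} {[]} le = id
merge-cancelˡ (left σ) {x ∷ _} {y ∷ _} le = ⊆-∷ (⊆-head le) (merge-cancelˡ σ (drop-∷-⊆ le))
merge-cancelˡ (right σ) {_} {_} {x ∷ _} {y ∷ _} le = merge-cancelˡ σ (drop-∷-⊆ le)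

merge-cancelʳ : ∀ (σ : Shuffle r t N) {S S′ T T′} → merge σ S T ⊆ merge σ S′ T′ → T ⊆ T′
merge-cancelʳ [] {[]} {[]} {[]} {[]} le = id
merge-cancelʳ (left σ) {x ∷ _} {y ∷ _} le = merge-cancelʳ σ (drop-∷-⊆ le)
merge-cancelʳ (right σ) {_} {_} {x ∷ _} {y ∷ _} le = ⊆-∷ (⊆-head le) (merge-cancelʳ σ (drop-∷-⊆ le))

merge-⊥ : (σ : Shuffle r t N) → merge σ ⊥ ⊥ ≡ ⊥
merge-⊥ []        = refl
merge-⊥ (left σ)  = cong (outside ∷_) (merge-⊥ σ)
merge-⊥ (right σ) = cong (outside ∷_) (merge-⊥ σ)

merge-⊤ : (σ : Shuffle r t N) → merge σ ⊤ ⊤ ≡ ⊤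
merge-⊤ []        = refl
merge-⊤ (left σ)  = cong (inside ∷_) (merge-⊤ σ)
merge-⊤ (right σ) = cong (inside ∷_) (merge-⊤ σ)

∣merge∣ : (σ : Shuffle r t N) (S : Subset r) (T : Subset t) → ∣ merge σ S T ∣ ≡ ∣ S ∣ + ∣ T ∣
∣merge∣ [] [] [] = refl
∣merge∣ (left σ) (true  ∷ S) T = cong suc (∣merge∣ σ S T)
∣merge∣ (left σ) (false ∷ S) T = ∣merge∣ σ S T
∣merge∣ (right σ) S (true  ∷ T) = trans (cong suc (∣merge∣ σ S T)) (sym (+-suc _ _))
∣merge∣ (right σ) S (false ∷ T) = ∣merge∣ σ S T

merge-copyˡ : ∀ (σ : Shuffle r t N) (T : Q t) → IsCopy r N (λ S → merge σ S T)
merge-copyˡ σ T = isCopy (λ _ _ le → merge-mono σ le ⊆-refl) (λ _ _ → merge-cancelˡ σ)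

merge-copyʳ : ∀ (σ : Shuffle r t N) (S : Q r) → IsCopy t N (merge σ S)
merge-copyʳ σ S = isCopy (λ _ _ le → merge-mono σ {S} ⊆-refl le) (λ _ _ → merge-cancelʳ σ)

allRight : ∀ N → Shuffle 0 N N
allRight zero    = []
allRight (suc N) = right (allRight N)

block : ∀ n → n + t ≤ N → ∃ λ m → Shuffle n m N × t ≤ m
block zero le = _ , allRight _ , le
block (suc n) (s≤s le) with m , σ , le′ ← block n le = m , left σ , le′

-- The left part holds the coordinates where `S` and `U` agree, frozen at `v`; the right part is `U`
-- minus `S`. So `merge σ v` parametrises the interval from `S` to `U`.
interval : ∀ {S U : Subset N} → S ⊆ U → ∃₂ λ t (σ : Shuffle (∣ S ∣ + ∣ ∁ U ∣) t N) →
           ∃ λ v → merge σ v ⊥ ≡ S × merge σ v ⊤ ≡ U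
interval {S = []} {[]} le = 0 , [] , [] , refl , refl
interval {S = true ∷ S} {true ∷ U} le with t , σ , v , lo , hi ← interval (drop-∷-⊆ le) =
  t , left σ , true ∷ v , cong (true ∷_) lo , cong (true ∷_) hi
interval {S = false ∷ S} {true ∷ U} le with t , σ , v , lo , hi ← interval (drop-∷-⊆ le) =
  suc t , right σ , v , cong (false ∷_) lo , cong (true ∷_) hi
interval {S = false ∷ S} {false ∷ U} le
  with t , σ , v , lo , hi ← interval (drop-∷-⊆ le) rewrite +-suc ∣ S ∣ ∣ ∁ U ∣ =
  t , left σ , false ∷ v , cong (false ∷_) lo , cong (false ∷_) hi
interval {S = true ∷ S} {false ∷ U} le = case ⊆-head le refl of λ ()

-- Blocks and the tower embedding.

pick : ∀ p (h : Q n → Bool) → Q n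
pick p h with anySubset? (λ T → h T ≟ p)
... | yes (T , _) = T
-- An arbitrary default that keeps `place` total; in this case every subset has colour `not p`.
... | no  _       = ⊥

pick-spec : ∀ p (h : Q n → Bool) → h (pick p h) ≡ p ⊎ (∀ T → h T ≡ not p)
pick-spec p h with anySubset? (λ T → h T ≟ p)
... | yes (T , e) = inj₁ e
... | no  none    = inj₂ (λ T → ¬-not (λ e → none (T , e)))

-- The set chosen inside k consecutive blocks of size n by a set of level j.  Lower blocks are filled
-- completely, so that choices at different levels are nested even for unrelated h.
place : ∀ k → k * n ≤ m → Bool → (Q m → Bool) → ℕ → Q m
place zero _ _ _ _ = ⊤
place {n} (suc k) le p h j with _ , σ , le′ ← block n le with j
... | zero  = merge σ (pick p (λ T → h (merge σ T ⊥))) ⊥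
... | suc i = merge σ ⊤ (place k le′ p (λ T → h (merge σ ⊤ T)) i)

place-mono : ∀ k (le : k * n ≤ m) p h h′ {i j} → i < j → place k le p h i ⊆ place k le p h′ j
place-mono zero le p h h′ _ = ⊆-refl
place-mono {n} (suc k) le p h h′ {i} {suc j} lt with _ , σ , le′ ← block n le with i | lt
... | zero  | _      = merge-mono σ ⊆⊤ ⊥⊆
... | suc i | s≤s lt = merge-mono σ {⊤} ⊆-refl (place-mono k le′ p _ _ lt)

place-full : ∀ k (le : k * n ≤ m) p h {j} → k ≤ j → place k le p h j ≡ ⊤
place-full zero le p h _ = refl
place-full {n} (suc k) le p h (s≤s le″) with _ , σ , le′ ← block n le =
  trans (cong (merge σ ⊤) (place-full k le′ p _ le″)) (merge-⊤ σ)

-- If block `j` offers no choice of colour `p`, its subsets, with all other coordinates fixed, form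
-- a copy of Q_n in the other colour.
place-spec : ∀ k (le : k * n ≤ m) p h {j} → j < k →
             h (place k le p h j) ≡ p ⊎ MonoCopy n m h (not p)
place-spec {n} (suc k) le p h {j} lt with _ , σ , le′ ← block n le with j | lt
... | zero | _ with pick-spec p (λ T → h (merge σ T ⊥))
...   | inj₁ e   = inj₁ e
...   | inj₂ all = inj₂ (_ , merge-copyˡ σ ⊥ , all)
place-spec {n} (suc k) le p h {j} lt | suc i | s≤s lt′ with place-spec k le′ p (λ T → h (merge σ ⊤ T)) lt′
...   | inj₁ e = inj₁ e
...   | inj₂ M = inj₂ (MonoCopy-∘ h (merge-copyʳ σ ⊤) M)

-- Index 0 means that the blocks have not begun: `suc ∣ S ∣ ∸ s` is 0 exactly when `∣ S ∣ < s`.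
lift : (ℕ → Q m) → ℕ → Q m
lift F zero    = ⊥
lift F (suc j) = F j

lift-mono : ∀ {F G : ℕ → Q m} → (∀ {i j} → i < j → F i ⊆ G j) →
            ∀ s {i j} → i < j → lift F (i ∸ s) ⊆ lift G (j ∸ s)
lift-mono mon zero    {zero}          lt       = ⊥⊆
lift-mono mon zero    {suc _} {suc _} (s≤s lt) = mon lt
lift-mono mon (suc s) {zero}          lt       = ⊥⊆
lift-mono mon (suc s) {suc _} {suc _} (s≤s lt) = lift-mono mon s lt

-- Levels below s and from s + k on need no block.
tower : ∀ (c : Colouring N) p (τ : Shuffle n m N) k → k * n ≤ m → ∀ s →
        (∀ S → ∣ S ∣ < s → c (merge τ S ⊥) ≡ p) →
        (∀ S → s + k ≤ ∣ S ∣ → c (merge τ S ⊤) ≡ p) →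
        Mono n N c
-- The map `f` is defined whatever the colours are; a single `S` where it misses `p` yields a whole
-- copy in the other colour.
tower {N = N} {n = n} {m} c p τ k le s low high = case anySubset? (λ S → ¬? (c (f S) ≟ p)) of λ
  { (yes (S , ne)) → case spec S of λ { (inj₁ e) → ⊥-elim (ne e) ; (inj₂ M) → mono c (not p) M }
  ; (no none)      → mono c p (f , f-copy , λ S → decidable-stable (c (f S) ≟ p) (λ ne → none (S , ne)))
  }
  where
  F : Q n → Q m
  F S = lift (place k le p (c ∘ merge τ S)) (suc ∣ S ∣ ∸ s)
  f : Q n → Q N
  f S = merge τ S (F S)
  -- Distinct comparable sets lie on different levels, so unrelated choices on one level never have
  -- to be nested.
  F-mono : S ⊆ S′ → F S ⊆ F S′
  F-mono sub with ⊆⇒≡⊎< sub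
  ... | inj₁ refl = ⊆-refl
  ... | inj₂ lt   = lift-mono (place-mono k le p _ _) s (s≤s lt)
  f-copy : IsCopy n N f
  f-copy = isCopy (λ _ _ sub → merge-mono τ sub (F-mono sub)) (λ _ _ → merge-cancelˡ τ)
  -- Three ranges of levels: below `s` the right part is ⊥, on the next `k` levels a block decides,
  -- and from there on all blocks are full.
  spec : ∀ S → c (f S) ≡ p ⊎ MonoCopy n N c (not p)
  spec S with ∣ S ∣ <? s
  ... | yes lt = inj₁ (trans
    (cong (λ j → c (merge τ S (lift (place k le p (c ∘ merge τ S)) j))) (m≤n⇒m∸n≡0 lt))
    (low S lt))
  ... | no ≮ with s≤ ← ≮⇒≥ ≮ with ∣ S ∣ ∸ s <? k
  ...   | yes lt rewrite +-∸-assoc 1 s≤ with place-spec k le p (c ∘ merge τ S) lt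
  ...     | inj₁ e = inj₁ e
  ...     | inj₂ M = inj₂ (MonoCopy-∘ c (merge-copyʳ τ S) M)
  spec S | no _ | no ≮ rewrite +-∸-assoc 1 s≤ = inj₁ (trans
    (cong (c ∘ merge τ S) (place-full k le p _ (≮⇒≥ ≮)))
    (high S (≤-trans (+-monoʳ-≤ s (≮⇒≥ ≮)) (≤-reflexive (m+[n∸m]≡n s≤)))))

-- Exchanging the ends of a copy.

stretch : Q N → Q N → (Q t → Q N) → Q t → Q N
stretch u w g T with ≡-dec _≟_ T ⊥ | ≡-dec _≟_ T ⊤
... | yes _ | _     = u
... | no  _ | yes _ = w
... | no  _ | no  _ = g T

module _ {u w : Q N} {g : Q t → Q N} (G : IsCopy t N g) (lo : u ⊆ g ⊥) (hi : g ⊤ ⊆ w) where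

  stretch-≤ : ∀ T → T ≢ ⊤ → stretch u w g T ⊆ g T
  stretch-≤ T ne with ≡-dec _≟_ T ⊥ | ≡-dec _≟_ T ⊤
  ... | yes refl | _     = lo
  ... | no  _    | yes e = ⊥-elim (ne e)
  ... | no  _    | no  _ = ⊆-refl

  stretch-≥ : ∀ T → T ≢ ⊥ → g T ⊆ stretch u w g T
  stretch-≥ T ne with ≡-dec _≟_ T ⊥ | ≡-dec _≟_ T ⊤
  ... | yes e | _        = ⊥-elim (ne e)
  ... | no  _ | yes refl = hi
  ... | no  _ | no  _    = ⊆-refl

  -- Away from ⊤ the new map lies below `g`, away from ⊥ above it, so both implications pass through
  -- `g`. The exceptional cases force `x ≡ y` or are trivial.
  stretch-copy : IsCopy t N (stretch u w g)
  stretch-copy = isCopy to from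
    where
    to : ∀ x y → x ⊆ y → stretch u w g x ⊆ stretch u w g y
    to x y le = case (≡-dec _≟_ x ⊤ , ≡-dec _≟_ y ⊥) of λ where
      (yes refl , _) → ⊆-reflexive (cong (stretch u w g) (⊆-antisym le ⊆⊤))
      (no _ , yes refl) → ⊆-reflexive (cong (stretch u w g) (⊆-antisym le ⊥⊆))
      (no x≢⊤ , no y≢⊥) →
        ⊆-trans (stretch-≤ x x≢⊤) (⊆-trans (copy-mono G x y le) (stretch-≥ y y≢⊥))
    from : ∀ x y → stretch u w g x ⊆ stretch u w g y → x ⊆ y
    from x y le = case (≡-dec _≟_ x ⊥ , ≡-dec _≟_ y ⊤) of λ where
      (yes refl , _) → ⊥⊆
      (no _ , yes refl) → ⊆⊤
      (no x≢⊥ , no y≢⊤) →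
        copy-cancel G x y (⊆-trans (stretch-≥ x x≢⊥) (⊆-trans le (stretch-≤ y y≢⊤)))

stretch-colour : ∀ (c : Colouring N) {p u w} {g : Q t → Q N} → c u ≡ p → c w ≡ p → ∀ T →
                 (T ≢ ⊥ → T ≢ ⊤ → c (g T) ≡ p) → c (stretch u w g T) ≡ p
stretch-colour c cu cw T h with ≡-dec _≟_ T ⊥ | ≡-dec _≟_ T ⊤
... | yes _ | _     = cu
... | no  _ | yes _ = cw
... | no a  | no b  = h a b

-- Atoms that agree in colour.

∣S∣≡0⇒S≡⊥ : ∣ S ∣ ≡ 0 → S ≡ ⊥
∣S∣≡0⇒S≡⊥ {S = []} _ = refl
∣S∣≡0⇒S≡⊥ {S = false ∷ S} e = cong (outside ∷_) (∣S∣≡0⇒S≡⊥ e)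

∣S∣<2⇒⊥⊎⁅⁆ : ∣ S ∣ < 2 → S ≡ ⊥ ⊎ ∃ λ i → S ≡ ⁅ i ⁆
∣S∣<2⇒⊥⊎⁅⁆ {S = []} _ = inj₁ refl
∣S∣<2⇒⊥⊎⁅⁆ {S = true ∷ S} (s≤s lt) = inj₂ (zero , cong (inside ∷_) (∣S∣≡0⇒S≡⊥ (n<1⇒n≡0 lt)))
∣S∣<2⇒⊥⊎⁅⁆ {S = false ∷ S} lt with ∣S∣<2⇒⊥⊎⁅⁆ {S = S} lt
... | inj₁ e       = inj₁ (cong (outside ∷_) e)
... | inj₂ (i , e) = inj₂ (suc i , cong (outside ∷_) e)

-- The chosen atoms form the left part of a shuffle, which is where `tower` puts Q_n.
MonoAtoms : ℕ → (Q N → Bool) → Bool → Set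
MonoAtoms {N} r h p = ∃₂ λ t (τ : Shuffle r t N) → ∀ i → h (merge τ ⁅ i ⁆ ⊥) ≡ p

-- Induction on the dimension: the colour of the first atom decides which of `r` and `s` drops by
-- one.
pigeonhole : ∀ (h : Q N → Bool) p r s → r + s ≤ suc N → MonoAtoms r h p ⊎ MonoAtoms s h (not p)
pigeonhole h p zero s le = inj₁ (_ , allRight _ , λ ())
pigeonhole h p (suc r) zero le = inj₂ (_ , allRight _ , λ ())
pigeonhole {zero} h p (suc r) (suc s) (s≤s le) with () ← subst (_≤ 0) (+-suc r s) le
pigeonhole {suc N} h p (suc r) (suc s) (s≤s le) with h (inside ∷ ⊥) ≟ p
... | yes e with pigeonhole (h ∘ (outside ∷_)) p r (suc s) le
...   | inj₁ (_ , τ , es) = inj₁ (_ , left τ , λ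
        { zero → trans (cong (h ∘ (inside ∷_)) (merge-⊥ τ)) e ; (suc i) → es i })
...   | inj₂ (_ , τ , es) = inj₂ (_ , right τ , es)
pigeonhole {suc N} h p (suc r) (suc s) (s≤s le) | no ne
  with pigeonhole (h ∘ (outside ∷_)) p (suc r) s (subst (_≤ suc N) (+-suc r s) le)
...   | inj₁ (_ , τ , es) = inj₁ (_ , right τ , es)
...   | inj₂ (_ , τ , es) = inj₂ (_ , left τ , λ
        { zero → trans (cong (h ∘ (inside ∷_)) (merge-⊥ τ)) (¬-not ne) ; (suc i) → es i })

-- For n = 2 + k, levels 0, 1 and n are free and the `k` levels between take a block each, in total
-- n + (n ∸ 2)n = n² ∸ n coordinates.
ends+atoms : ∀ k (c : Colouring N) p {u w : Q N} {g : Q t → Q N} → IsCopy t N g →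
             u ⊆ g ⊥ → g ⊤ ⊆ w → c u ≡ p → c w ≡ p →
             (2 + k) + k * (2 + k) ≤ t → MonoAtoms (2 + k) (c ∘ g) p → Mono (2 + k) N c
ends+atoms {t = t} k c p {u} {w} {g} G lo hi cu cw le (m , τ , atoms) =
  Mono-∘ c (stretch-copy G lo hi) (tower c′ p τ k room 2 low high)
  where
  c′ = c ∘ stretch u w g
  room : k * (2 + k) ≤ m
  room = +-cancelˡ-≤ (2 + k) _ _ (≤-trans le (≤-reflexive (sym (shuffle-size τ))))
  low : ∀ S → ∣ S ∣ < 2 → c′ (merge τ S ⊥) ≡ p
  low S lt with ∣S∣<2⇒⊥⊎⁅⁆ {S = S} lt
  ... | inj₁ refl = stretch-colour c cu cw _ (λ ne → ⊥-elim (ne (merge-⊥ τ)))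
  ... | inj₂ (i , refl) = stretch-colour c cu cw (merge τ ⁅ i ⁆ ⊥) (λ _ _ → atoms i)
  high : ∀ S → 2 + k ≤ ∣ S ∣ → c′ (merge τ S ⊤) ≡ p
  high S ge with refl ← ∣p∣≡n⇒p≡⊤ {p = S} (≤-antisym (∣p∣≤n S) ge) =
    stretch-colour c cu cw _ (λ _ ne → ⊥-elim (ne (merge-⊤ τ)))

-- Atoms and coatoms of the other colour.

rest≥ : ∀ {b} → Shuffle r t N → r ≤ 2 → 2 + b ≤ N → b ≤ t
rest≥ {r} {t} σ r≤2 le = +-cancelˡ-≤ 2 _ _
  (≤-trans le (≤-trans (≤-reflexive (sym (shuffle-size σ))) (+-monoˡ-≤ t r≤2)))

-- By pigeonhole below `U` there are n atoms of colour `p`, which finish with the ends ⊥ and `w`, or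
-- one atom of the other colour.
atom-of-other-colour : ∀ k (c : Colouring N) p {U w : Q N} → 2 + ((2 + k) + k * (2 + k)) ≤ N →
           U ⊆ w → ∣ ∁ U ∣ ≤ 2 → c ⊥ ≡ p → c w ≡ p →
           Mono (2 + k) N c ⊎ ∃ λ X → ∣ X ∣ ≡ 1 × X ⊆ U × c X ≡ not p
atom-of-other-colour {N} k c p {U} {w} le U⊆w ∣∁U∣≤2 c⊥ cw
  with t , σ , v , lo , hi ← interval {S = ⊥} {U} ⊥⊆ =
  case pigeonhole (c ∘ merge σ v) p (2 + k) 1
         (subst (_≤ suc t) (+-comm 1 (2 + k)) (s≤s (m+n≤o⇒m≤o (2 + k) room))) of λ where
    (inj₁ atoms) → inj₁ (ends+atoms k c p (merge-copyʳ σ v) ⊥⊆ (⊆-trans (⊆-reflexive hi) U⊆w) c⊥ cw room atoms)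
    (inj₂ (_ , τ , e)) → inj₂ (merge σ v (merge τ ⁅ zero ⁆ ⊥) , size τ ,
                               (λ {_} → ⊆-trans (merge-mono σ {v} ⊆-refl ⊆⊤) (⊆-reflexive hi)) , e zero)
  where
  room : (2 + k) + k * (2 + k) ≤ t
  room = rest≥ σ (subst (λ s → s + ∣ ∁ U ∣ ≤ 2) (sym (∣⊥∣≡0 N)) ∣∁U∣≤2) le
  -- The lower end is ⊥, so `v` is empty and atoms of the interval are atoms of the whole lattice.
  ∣v∣≡0 : ∣ v ∣ ≡ 0
  ∣v∣≡0 = m+n≡0⇒m≡0 ∣ v ∣ (trans (sym (∣merge∣ σ v ⊥)) (trans (cong ∣_∣ lo) (∣⊥∣≡0 N)))
  size : (τ : Shuffle 1 m t) → ∣ merge σ v (merge τ ⁅ zero ⁆ ⊥) ∣ ≡ 1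
  size {m} τ = trans (∣merge∣ σ v _) (trans (cong₂ _+_ ∣v∣≡0 (∣merge∣ τ _ ⊥)) (cong suc (∣⊥∣≡0 m)))

-- This is `atom-of-other-colour` for `c ∘ ∁`, with `∁ S` as both `U` and `w`.
coatom-of-other-colour : ∀ k (c : Colouring N) p {S : Q N} → 2 + ((2 + k) + k * (2 + k)) ≤ N →
             ∣ S ∣ ≤ 2 → c S ≡ p → c ⊤ ≡ p →
             Mono (2 + k) N c ⊎ ∃ λ U → ∣ ∁ U ∣ ≡ 1 × S ⊆ U × c U ≡ not p
coatom-of-other-colour {N} k c p {S} le ∣S∣≤2 cS c⊤
  with atom-of-other-colour k (c ∘ ∁) p {∁ S} {∁ S} le ⊆-refl
         (subst (λ T → ∣ T ∣ ≤ 2) (sym (∁-involutive S)) ∣S∣≤2)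
         (trans (cong c (∁⊥≡⊤ N)) c⊤) (trans (cong c (∁-involutive S)) cS)
... | inj₁ M = inj₁ (Mono-dual c M)
... | inj₂ (X , ∣X∣ , sub , e) =
  inj₂ (∁ X , trans (cong ∣_∣ (∁-involutive X)) ∣X∣ ,
        ⊆-trans (⊆-reflexive (sym (∁-involutive S))) (p⊆q⇒∁p⊇∁q sub) , e)

-- Pigeonhole does not prescribe the colour of the n atoms, so ends of either colour must be at
-- hand.
both-colours-outside : ∀ k (c : Colouring N) {S U : Q N} → 2 + ((3 + k) + (1 + k) * (3 + k)) ≤ N →
         S ⊆ U → ∣ S ∣ + ∣ ∁ U ∣ ≤ 2 →
         (∀ p → ∃ λ u → u ⊆ S × c u ≡ p) → (∀ p → ∃ λ w → U ⊆ w × c w ≡ p) →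
         Mono (3 + k) N c
both-colours-outside k c {S} {U} le S⊆U small below above
  with t , σ , v , lo , hi ← interval S⊆U =
  case pigeonhole (c ∘ merge σ v) red (3 + k) (3 + k) half of λ where
    (inj₁ atoms) → win σ v lo hi red atoms
    (inj₂ atoms) → win σ v lo hi blue atoms
  where
  win : ∀ {t} (σ : Shuffle _ t _) v → merge σ v ⊥ ≡ S → merge σ v ⊤ ≡ U →
        ∀ p → MonoAtoms (3 + k) (c ∘ merge σ v) p → Mono (3 + k) _ c
  win σ v lo hi p atoms with u , u⊆S , cu ← below p | w , U⊆w , cw ← above p =
    ends+atoms (1 + k) c p (merge-copyʳ σ v) (⊆-trans u⊆S (⊆-reflexive (sym lo))) (⊆-trans (⊆-reflexive hi) U⊆w)
      cu cw (rest≥ σ small le) atoms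
  -- Here n ≥ 3 enters, as 2n ≤ n² ∸ n.
  half : 3 + k + (3 + k) ≤ suc t
  half = ≤-trans (+-monoʳ-≤ (3 + k) (m≤m+n (3 + k) (k * (3 + k)))) (≤-trans (rest≥ σ small le) (n≤1+n t))

-- The case n ≥ 3.

arrows : ∀ k → Arrows (2 + ((3 + k) + (1 + k) * (3 + k))) (3 + k) (3 + k)
arrows k c with anySubset? (λ S → (∣ S ∣ ≤? 2) ×-dec (c S ≟ c ⊤))
... | no none with t , τ , le ← block (3 + k) (m≤n+m _ 2) =
  -- The `1 + k` blocks serve levels 3 to n; no level reaches `3 + (1 + k)`, so the last condition
  -- is vacuous.
  tower c (not (c ⊤)) τ (1 + k) le 3 low (λ S ge → ⊥-elim (<-irrefl refl (≤-trans ge (∣p∣≤n S))))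
  where
  low : ∀ S → ∣ S ∣ < 3 → c (merge τ S ⊥) ≡ not (c ⊤)
  low S (s≤s le) = ¬-not (λ e → none (_ , subst (_≤ 2) (sym size) le , e))
    where
    size : ∣ merge τ S ⊥ ∣ ≡ ∣ S ∣
    size = trans (∣merge∣ τ S ⊥) (trans (cong (∣ S ∣ +_) (∣⊥∣≡0 t)) (+-identityʳ _))
... | yes (S , ∣S∣≤2 , cS) with coatom-of-other-colour (1 + k) c (c ⊤) ≤-refl ∣S∣≤2 cS refl
...   | inj₁ M = M
...   | inj₂ (U , ∣∁U∣ , _ , cU) = finish (above (c ⊥))
  where
  above : ∀ p → ∃ λ w → U ⊆ w × c w ≡ p
  above p with p ≟ c ⊤
  ... | yes e = ⊤ , ⊆⊤ , sym e
  ... | no ne = U , ⊆-refl , trans cU (sym (¬-not ne))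
  finish : (∃ λ w → U ⊆ w × c w ≡ c ⊥) → Mono (3 + k) _ c
  finish (w , U⊆w , cw)
    with atom-of-other-colour (1 + k) c (c ⊥) ≤-refl U⊆w (subst (_≤ 2) (sym ∣∁U∣) (s≤s z≤n)) refl cw
  ... | inj₁ M = M
  ... | inj₂ (X , ∣X∣ , X⊆U , cX) =
    -- Fixing `X` and `∁ U` costs exactly the two coordinates beyond n² ∸ n.
    both-colours-outside k c ≤-refl X⊆U (≤-reflexive (cong₂ _+_ ∣X∣ ∣∁U∣)) below above
    where
    below : ∀ p → ∃ λ u → u ⊆ X × c u ≡ p
    below p with p ≟ c ⊥
    ... | yes e = ⊥ , ⊥⊆ , sym e
    ... | no ne = X , ⊆-refl , trans cX (sym (¬-not ne))

-- The cases n = 1 and n = 2.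

chain-copy : {a b : Q N} → a ⊆ b → b ⊈ a → IsCopy 1 N (λ { (false ∷ []) → a ; (true ∷ []) → b })
chain-copy {a = a} {b} a⊆b b⊈a = isCopy
  (λ { (false ∷ []) (false ∷ []) le → ⊆-refl
     ; (false ∷ []) (true  ∷ []) le → a⊆b
     ; (true  ∷ []) (false ∷ []) le → case ⊆-head le refl of λ ()
     ; (true  ∷ []) (true  ∷ []) le → ⊆-refl })
  (λ { (false ∷ []) y le → ⊥⊆
     ; (true  ∷ []) (false ∷ []) le → ⊥-elim (b⊈a le)
     ; (true  ∷ []) (true  ∷ []) le → ⊆-refl })

chain : ∀ (c : Colouring N) p {a b} → a ⊆ b → b ⊈ a → c a ≡ p → c b ≡ p → Mono 1 N c
chain c p a⊆b b⊈a ca cb = mono c p (_ , chain-copy a⊆b b⊈a , λ { (false ∷ []) → ca ; (true ∷ []) → cb })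

-- Two of ⊥, an atom and ⊤ agree in colour, and any two of them form a chain.
arrows₁ : Arrows 2 1 1
arrows₁ c with c ⊥ ≟ c ⊤ | c ⊥ ≟ c ⁅ zero ⁆
... | yes e | _     = chain c (c ⊤) ⊥⊆ (λ le → case ⊆-head le refl of λ ()) e refl
... | no  _ | yes e = chain c (c ⁅ zero ⁆) ⊥⊆ (λ le → case ⊆-head le refl of λ ()) e refl
... | no ne | no ne′ = chain c (c ⊤) {⁅ zero ⁆} ⊆⊤ (λ le → case ⊆-head (drop-∷-⊆ le) refl of λ ())
  (trans (¬-not (ne′ ∘ sym)) (sym (¬-not (ne ∘ sym)))) refl

diamond : Q N → Q N → Q N → Q N → Q 2 → Q N
diamond a b d e (false ∷ false ∷ []) = a
diamond a b d e (true  ∷ false ∷ []) = b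
diamond a b d e (false ∷ true  ∷ []) = d
diamond a b d e (true  ∷ true  ∷ []) = e

-- Any further inclusion, such as `e ⊆ a`, would make `b` and `d` comparable.
diamond-copy : ∀ {a b d e : Q N} → a ⊆ b → a ⊆ d → b ⊆ e → d ⊆ e → b ⊈ d → d ⊈ b →
               IsCopy 2 N (diamond a b d e)
diamond-copy {a = a} {b} {d} {e} ab ad be de bd db = isCopy to from
  where
  to : ∀ x y → x ⊆ y → diamond a b d e x ⊆ diamond a b d e y
  to (false ∷ false ∷ []) (false ∷ false ∷ []) _ = ⊆-refl
  to (false ∷ false ∷ []) (true  ∷ false ∷ []) _ = ab
  to (false ∷ false ∷ []) (false ∷ true  ∷ []) _ = ad
  to (false ∷ false ∷ []) (true  ∷ true  ∷ []) _ = ⊆-trans ab be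
  to (true  ∷ false ∷ []) (true  ∷ false ∷ []) _ = ⊆-refl
  to (true  ∷ false ∷ []) (true  ∷ true  ∷ []) _ = be
  to (false ∷ true  ∷ []) (false ∷ true  ∷ []) _ = ⊆-refl
  to (false ∷ true  ∷ []) (true  ∷ true  ∷ []) _ = de
  to (true  ∷ true  ∷ []) (true  ∷ true  ∷ []) _ = ⊆-refl
  to (true  ∷ _     ∷ []) (false ∷ _     ∷ []) le = case ⊆-head le refl of λ ()
  to (_     ∷ true  ∷ []) (_     ∷ false ∷ []) le = case ⊆-head (drop-∷-⊆ le) refl of λ ()
  from : ∀ x y → diamond a b d e x ⊆ diamond a b d e y → x ⊆ y
  from (false ∷ false ∷ []) _ _ = ⊥⊆
  from _ (true ∷ true ∷ []) _ = ⊆⊤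
  from (true  ∷ false ∷ []) (true  ∷ false ∷ []) _ = ⊆-refl
  from (false ∷ true  ∷ []) (false ∷ true  ∷ []) _ = ⊆-refl
  from (true  ∷ false ∷ []) (false ∷ true  ∷ []) le = ⊥-elim (bd le)
  from (false ∷ true  ∷ []) (true  ∷ false ∷ []) le = ⊥-elim (db le)
  from (true  ∷ false ∷ []) (false ∷ false ∷ []) le = ⊥-elim (bd (⊆-trans le ad))
  from (false ∷ true  ∷ []) (false ∷ false ∷ []) le = ⊥-elim (db (⊆-trans le ab))
  from (true  ∷ true  ∷ []) (false ∷ false ∷ []) le = ⊥-elim (bd (⊆-trans be (⊆-trans le ad)))
  from (true  ∷ true  ∷ []) (true  ∷ false ∷ []) le = ⊥-elim (db (⊆-trans de le))
  from (true  ∷ true  ∷ []) (false ∷ true  ∷ []) le = ⊥-elim (bd (⊆-trans be le))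

-- Each condition precedes the quantifiers it does not involve, so that `hasDiamond?` drops failing
-- choices early.
HasDiamond : List (Q N) → Set
HasDiamond L = Any (λ a → Any (λ b → a ⊆ b × Any (λ d → a ⊆ d × b ⊈ d × d ⊈ b ×
                 Any (λ e → b ⊆ e × d ⊆ e) L) L) L) L

hasDiamond? : (L : List (Q N)) → Dec (HasDiamond L)
hasDiamond? L = any? (λ a → any? (λ b → (a ⊆? b) ×-dec
                  any? (λ d → (a ⊆? d) ×-dec ¬? (b ⊆? d) ×-dec ¬? (d ⊆? b) ×-dec
                  any? (λ e → (b ⊆? e) ×-dec (d ⊆? e)) L) L) L) L

diamond⇒mono : ∀ (c : Colouring N) p {L} → HasDiamond L → All (λ x → c x ≡ p) L → Mono 2 N c
diamond⇒mono c p h col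
  with ca , h₁ ← All.lookupAny col h
  with cb , ab , h₂ ← All.lookupAny col h₁
  with cd , ad , bd , db , h₃ ← All.lookupAny col h₂
  with ce , be , de ← All.lookupAny col h₃ =
  mono c p (_ , diamond-copy ab ad be de bd db , λ
    { (false ∷ false ∷ []) → ca ; (true ∷ false ∷ []) → cb
    ; (false ∷ true  ∷ []) → cd ; (true ∷ true  ∷ []) → ce })

Settled : List (Q N) → List (Q N) → Set
Settled {N} R B = ∀ (c : Colouring N) → All (λ x → c x ≡ red) R → All (λ x → c x ≡ blue) B → Mono 2 N c

-- Backtracking: R and B are the sets already coloured red and blue, L those still to be coloured.
settle : (L R B : List (Q N)) → Maybe (Settled R B)
settle L R B with hasDiamond? R | hasDiamond? B
... | yes h | _     = just (λ c rs _ → diamond⇒mono c red h rs)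
... | no  _ | yes h = just (λ c _ bs → diamond⇒mono c blue h bs)
settle []      R B | no _ | no _ = nothing
settle (x ∷ L) R B | no _ | no _ = zipWith branch (settle L (x ∷ R) B) (settle L R (x ∷ B))
  where
  branch : Settled (x ∷ R) B → Settled R (x ∷ B) → Settled R B
  branch f g c rs bs with c x in e
  ... | true  = f c (e ∷ rs) bs
  ... | false = g c rs (e ∷ bs)

arrows₂ : Arrows 4 2 2
-- The type of `from-just` is the required one only if the search evaluates to `just`, so type
-- checking runs the search.
arrows₂ c = from-just (settle order [] []) c [] []
  where
  pattern i = inside
  pattern o = outside
  -- This order keeps the search tree small.
  order : List (Q 4)
  order =
    (i ∷ i ∷ i ∷ i ∷ []) ∷ (o ∷ o ∷ i ∷ o ∷ []) ∷ (o ∷ i ∷ o ∷ o ∷ []) ∷ (o ∷ o ∷ o ∷ o ∷ []) ∷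
    (o ∷ i ∷ i ∷ i ∷ []) ∷ (i ∷ i ∷ i ∷ o ∷ []) ∷ (i ∷ i ∷ o ∷ o ∷ []) ∷ (o ∷ i ∷ i ∷ o ∷ []) ∷
    (o ∷ o ∷ i ∷ i ∷ []) ∷ (o ∷ i ∷ o ∷ i ∷ []) ∷ (i ∷ o ∷ i ∷ o ∷ []) ∷ (i ∷ o ∷ i ∷ i ∷ []) ∷
    (i ∷ i ∷ o ∷ i ∷ []) ∷ (i ∷ o ∷ o ∷ o ∷ []) ∷ (o ∷ o ∷ o ∷ i ∷ []) ∷ (i ∷ o ∷ o ∷ i ∷ []) ∷ []

theorem5 : (n : ℕ) → 1 ≤ n → RamseyLE n n (n * n ∸ n + 2)
theorem5 1 _ = 2 , ≤-refl , arrows₁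
theorem5 2 _ = 4 , ≤-refl , arrows₂
theorem5 (suc (suc (suc k))) _ = _ , ≤-reflexive size , arrows k
  where
  size : 2 + ((3 + k) + (1 + k) * (3 + k)) ≡ (3 + k) * (3 + k) ∸ (3 + k) + 2
  -- By definition `(3 + k) * (3 + k)` is `(3 + k) + (2 + k) * (3 + k)`, and the second summand
  -- unfolds likewise.
  size = trans (+-comm 2 _) (cong (_+ 2) (sym (m+n∸m≡n (3 + k) ((2 + k) * (3 + k)))))
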